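{- Let $\Phi(a,b)$ be the $6\times 6$ array of vectors in $\mathbb{C}^6$, depending on real $a,b>0$ with $a^2+b^2=1$, defined in the context. Then the array $\Phi_{23}=\Phi\left(\frac{1}{\sqrt2},\frac{1}{\sqrt2}\right)$ is a quantum Latin square of order $6$ and its cardinality is $23$.
   Context: A quantum Latin square of order $n$, denoted $\mathrm{QLS}(n)$, is an $n\times n$ array of unit vectors in $\mathbb{C}^n$ such that every row and every column forms an orthonormal basis of $\mathbb{C}^n$. Two unit vectors $u,v$ are phase equivalent if $u=e^{i\alpha}v$ for some $\alpha\in\mathbb{R}$. The cardinality of a quantum Latin square is the number of distinct phase-equivalence classes among its $n^2$ entries. Let $e_0,\dots,e_5$ be the standard basis of $\mathbb{C}^6=\mathcal U\oplus\mathcal V$, where $\mathcal U=\operatorname{span}\{e_0,e_1,e_2,e_3\}$ and $\mathcal V=\operatorname{span}\{e_4,e_5\}$. Let $\rho=1/\sqrt2$, and let $a,b>0$ be real with $a^2+b^2=1$. A $4$-tuple $(t_0,t_1,t_2,t_3)$ denotes the vector $t_0e_0+t_1e_1+t_2e_2+t_3e_3\in\mathcal U$. Define the following vectors of $\mathcal U$: $A=(1,0,0,0)$, $B=(0,1,0,0)$, $C=(0,0,1,0)$, $D=(0,0,0,1)$, $E=(0,a,b\rho,b\rho)$, $F=(a,0,b\rho,-b\rho)$, $G=(b\rho,-b\rho,0,a)$, $H=(-b\rho,-b\rho,a,0)$, $I=(0,-b,a\rho,a\rho)$, $J=(-b,0,a\rho,-a\rho)$, $K=(-a\rho,a\rho,0,b)$,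 $L=(a\rho,a\rho,b,0)$, $M=(-a\rho,a\rho,b,0)$, $N=(b\rho,-b\rho,a,0)$, $O=(\rho,\rho,0,0)$, $P=(a\rho,a\rho,0,b)$, $Q=(-b\rho,-b\rho,0,a)$, $R=(-\rho,\rho,0,0)$, $S=(0,0,\rho,\rho)$, $T=(b,0,a\rho,-a\rho)$, $U=(-a,0,b\rho,-b\rho)$. Define in $\mathcal V$: $x=e_4$, $y=e_5$, $z=\rho(e_4+e_5)$, $w=\rho(e_4-e_5)$. Set $$\Phi(a,b)=\begin{pmatrix} x & A & y & B & C & D \\ y & x & E & F & G & H \\ I & y & x & J & K & L \\ M & D & N & z & O & w \\ P & C & Q & w & z & R \\ T & B & U & S & w & z \end{pmatrix}.$$ -}

module Defs where

open import Algebra.Bundles.Raw using (RawRing)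
import Algebra.Definitions.RawSemiring as RawSemiringDefs
open import Data.Bool.Base using (if_then_else_)
open import Data.Empty using (⊥-elim)
open import Data.Fin.Base using (Fin; toℕ)
open import Data.Integer.Base as ℤ using (-[1+_]) renaming (+_ to pos)
import Data.Integer.Properties as ℤ
import Data.Nat.Coprimality as Coprime
open import Data.Nat.Base as ℕ using (ℕ; zero; suc; _!; _⊔_)
import Data.Nat.Properties as ℕ
open import Data.Product.Base using (Σ-syntax; ∃-syntax; _×_; _,_; proj₁; proj₂)
open import Data.Rational.Base as ℚ
  using (ℚ; mkℚ; 0ℚ; 1ℚ; ½; ∣_∣; _+_; _*_; _-_; -_; _<_; _≤_; 1/_; positive; nonNegative; Positive)
open import Data.Rational.Properties
open import Data.Rational.Solver using (module +-*-Solver)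
import Data.Rational.Unnormalised.Base as ℚᵘ
import Data.Rational.Unnormalised.Properties as ℚᵘ
open import Data.Sum.Base using (inj₁; inj₂)
open import Data.Vec.Functional using (Vector; []; _∷_)
open import Function.Definitions using (Bijective)
open import Level using (0ℓ)
open import Relation.Binary.PropositionalEquality
  using (_≡_; _≢_; refl; sym; trans; cong; subst; subst₂)
open import Relation.Nullary using (Dec; yes; no; does)
open import Relation.Nullary.Decidable using (toWitness)

-- A real number is a Cauchy sequence of rationals; equality _≈ᴿ_ of reals is
-- equality up to a null sequence.

IsCauchy : (ℕ → ℚ) → Set
IsCauchy x = ∀ ε → 0ℚ < ε → ∃[ N ] ∀ m n → N ℕ.≤ m → N ℕ.≤ n → ∣ x m - x n ∣ < ε

record ℝ : Set where
  constructor mkℝ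
  field
    seq    : ℕ → ℚ
    cauchy : IsCauchy seq

open ℝ public

infix 4 _≈ᴿ_ _<ᴿ_

_≈ᴿ_ : ℝ → ℝ → Set
x ≈ᴿ y = ∀ ε → 0ℚ < ε → ∃[ N ] ∀ n → N ℕ.≤ n → ∣ seq x n - seq y n ∣ < ε

_<ᴿ_ : ℝ → ℝ → Set
x <ᴿ y = ∃[ δ ] 0ℚ < δ × ∃[ N ] ∀ n → N ℕ.≤ n → seq x n + δ ≤ seq y n

0<½* : ∀ {ε} → 0ℚ < ε → 0ℚ < ½ * ε
0<½* {ε} p = subst (_< ½ * ε) (*-zeroʳ ½) (*-monoʳ-<-pos ½ p)

half : ∀ ε → ½ * ε + ½ * ε ≡ ε
half ε = trans (sym (*-distribʳ-+ ε ½ ½)) (*-identityˡ ε)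

∣0∣< : ∀ q {ε} → 0ℚ < ε → ∣ q - q ∣ < ε
∣0∣< q {ε} p = subst (λ r → ∣ r ∣ < ε) (sym (+-inverseʳ q)) p

open +-*-Solver using (solve; _:+_; _:*_; _:-_; :-_; _:=_; con)

const-cauchy : ∀ q → IsCauchy (λ _ → q)
const-cauchy q ε 0<ε = 0 , λ _ _ _ _ → ∣0∣< q 0<ε

abstract

  +-cauchy : ∀ {x y} → IsCauchy x → IsCauchy y → IsCauchy (λ n → x n + y n)
  +-cauchy {x} {y} cx cy ε 0<ε
    with cx (½ * ε) (0<½* 0<ε) | cy (½ * ε) (0<½* 0<ε)
  ... | M , hM | N , hN = M ⊔ N , λ m n p q →
    subst (λ r → ∣ r ∣ < ε) (eq (x m) (x n) (y m) (y n))
      (subst (∣ (x m - x n) + (y m - y n) ∣ <_) (half ε)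
        (≤-<-trans (∣p+q∣≤∣p∣+∣q∣ (x m - x n) (y m - y n))
          (+-mono-<
            (hM m n (ℕ.m⊔n≤o⇒m≤o M N p) (ℕ.m⊔n≤o⇒m≤o M N q))
            (hN m n (ℕ.m⊔n≤o⇒n≤o M N p) (ℕ.m⊔n≤o⇒n≤o M N q)))))
    where
    eq : ∀ a b c d → (a - b) + (c - d) ≡ (a + c) - (b + d)
    eq = solve 4 (λ a b c d → ((a :- b) :+ (c :- d)) := ((a :+ c) :- (b :+ d))) refl

  neg-cauchy : ∀ {x} → IsCauchy x → IsCauchy (λ n → - x n)
  neg-cauchy {x} cx ε 0<ε with cx ε 0<ε
  ... | N , h = N , λ m n p q →
    subst (_< ε) (trans (sym (∣-p∣≡∣p∣ (x m - x n))) (cong ∣_∣ (eq (x m) (x n)))) (h m n p q)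
    where
    eq : ∀ a b → - (a - b) ≡ (- a) - (- b)
    eq = solve 2 (λ a b → (:- (a :- b)) := ((:- a) :- (:- b))) refl

bounded : ∀ {x} → IsCauchy x →
          ∃[ B ] 0ℚ < B × ∃[ N ] ∀ n → N ℕ.≤ n → ∣ x n ∣ ≤ B
bounded {x} cx with cx 1ℚ (positive⁻¹ 1ℚ)
... | N , h = ∣ x N ∣ + 1ℚ
    , +-mono-≤-< (0≤∣p∣ (x N)) (positive⁻¹ 1ℚ)
    , N , λ n p →
  subst (λ r → ∣ r ∣ ≤ ∣ x N ∣ + 1ℚ) (eq (x N) (x n))
    (≤-trans (∣p+q∣≤∣p∣+∣q∣ (x N) (x n - x N))
      (+-monoʳ-≤ ∣ x N ∣ (<⇒≤ (h n N p ℕ.≤-refl))))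
  where
  eq : ∀ a b → a + (b - a) ≡ b
  eq = solve 2 (λ a b → (a :+ (b :- a)) := b) refl

scale : ∀ {B C ε} → 0ℚ < B → 0ℚ < C → 0ℚ < ε →
        ∃[ δ ] 0ℚ < δ × B * δ + C * δ ≡ ε
scale {B} {C} {ε} 0<B 0<C 0<ε =
    ε * r
  , positive⁻¹ (ε * r) {{pos*pos⇒pos ε {{positive 0<ε}} r {{1/pos⇒pos (B + C)}}}}
  , trans (eq B C ε r) (trans (cong (ε *_) (*-inverseʳ (B + C))) (*-identityʳ ε))
  where
  instance
    B+C-positive : Positive (B + C)
    B+C-positive = positive (+-mono-< 0<B 0<C)
    B+C-nonZero : ℚ.NonZero (B + C)
    B+C-nonZero = pos⇒nonZero (B + C)
  r : ℚ
  r = 1/ (B + C)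
  eq : ∀ b c e i → b * (e * i) + c * (e * i) ≡ e * ((b + c) * i)
  eq = solve 4 (λ b c e i → (b :* (e :* i) :+ c :* (e :* i)) := (e :* ((b :+ c) :* i))) refl

*-bound : ∀ {B δ} p q → 0ℚ < B → ∣ p ∣ ≤ B → ∣ q ∣ < δ → ∣ p * q ∣ < B * δ
*-bound {B} {δ} p q 0<B p≤B q<δ = subst (_< B * δ) (sym (∣p*q∣≡∣p∣*∣q∣ p q))
  (≤-<-trans (*-monoʳ-≤-nonNeg ∣ q ∣ {{∣-∣-nonNeg q}} p≤B)
             (*-monoʳ-<-pos B {{positive 0<B}} q<δ))

*-diff : ∀ a b c d → a * (c - d) + d * (a - b) ≡ a * c - b * d
*-diff = solve 4 (λ a b c d → (a :* (c :- d) :+ d :* (a :- b)) := (a :* c :- b :* d)) refl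

abstract

  *-cauchy : ∀ {x y} → IsCauchy x → IsCauchy y → IsCauchy (λ n → x n * y n)
  *-cauchy {x} {y} cx cy ε 0<ε =
    let B , 0<B , K , hB = bounded {x} cx
        C , 0<C , L , hC = bounded {y} cy
        δ , 0<δ , δ-eq   = scale 0<B 0<C 0<ε
        M , hM           = cx δ 0<δ
        N , hN           = cy δ 0<δ
    in (K ⊔ L) ⊔ (M ⊔ N) , λ m n p q →
    let p₁ = ℕ.m⊔n≤o⇒m≤o (K ⊔ L) (M ⊔ N) p
        p₂ = ℕ.m⊔n≤o⇒n≤o (K ⊔ L) (M ⊔ N) p
        q₁ = ℕ.m⊔n≤o⇒m≤o (K ⊔ L) (M ⊔ N) q
        q₂ = ℕ.m⊔n≤o⇒n≤o (K ⊔ L) (M ⊔ N) q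
        s₁ = *-bound (x m) (y m - y n) 0<B (hB m (ℕ.m⊔n≤o⇒m≤o K L p₁))
               (hN m n (ℕ.m⊔n≤o⇒n≤o M N p₂) (ℕ.m⊔n≤o⇒n≤o M N q₂))
        s₂ = *-bound (y n) (x m - x n) 0<C (hC n (ℕ.m⊔n≤o⇒n≤o K L q₁))
               (hM m n (ℕ.m⊔n≤o⇒m≤o M N p₂) (ℕ.m⊔n≤o⇒m≤o M N q₂))
    in subst₂ (λ r s → ∣ r ∣ < s) (*-diff (x m) (x n) (y m) (y n)) δ-eq
         (≤-<-trans (∣p+q∣≤∣p∣+∣q∣ (x m * (y m - y n)) (y n * (x m - x n)))
                    (+-mono-< s₁ s₂))

fromℚ : ℚ → ℝ
fromℚ q = mkℝ (λ _ → q) (const-cauchy q)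

0ᴿ 1ᴿ : ℝ
0ᴿ = fromℚ 0ℚ
1ᴿ = fromℚ 1ℚ

infixl 6 _+ᴿ_
infixl 7 _*ᴿ_
infix  8 -ᴿ_

_+ᴿ_ _*ᴿ_ : ℝ → ℝ → ℝ
mkℝ x cx +ᴿ mkℝ y cy = mkℝ (λ n → x n + y n) (+-cauchy {x} {y} cx cy)
mkℝ x cx *ᴿ mkℝ y cy = mkℝ (λ n → x n * y n) (*-cauchy {x} {y} cx cy)

-ᴿ_ : ℝ → ℝ
-ᴿ mkℝ x cx = mkℝ (λ n → - x n) (neg-cauchy {x} cx)

-- The real number ρ = 1/√2, by bisection of [½ , 1]:
-- (lower n)² ≤ ½ < (lower n + width n)²

width : ℕ → ℚ
width zero    = ½
width (suc n) = ½ * width n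

lower : ℕ → ℚ
lower zero    = ½
lower (suc n) =
  let mid = lower n + width (suc n)
  in if does (mid * mid ≤? ½) then mid else lower n

0<width : ∀ n → 0ℚ < width n
0<width zero    = positive⁻¹ ½
0<width (suc n) = 0<½* (0<width n)

width-suc : ∀ n → width (suc n) ≤ width n
width-suc n = subst (_≤ width n) (+-identityˡ _)
  (subst (0ℚ + width (suc n) ≤_) (half (width n))
    (+-monoˡ-≤ (width (suc n)) (<⇒≤ (0<width (suc n)))))

width-antitone : ∀ {m n} → m ℕ.≤′ n → width n ≤ width m
width-antitone ℕ.≤′-refl               = ≤-refl
width-antitone (ℕ.≤′-step {n = n} m≤n) = ≤-trans (width-suc n) (width-antitone m≤n)

Brackets : ℚ → ℚ → Set
Brackets l w = ½ ≤ l × l * l ≤ ½ × ½ < (l + w) * (l + w)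

brackets-step : ∀ l w → 0ℚ < w → Brackets l w →
  let mid = l + ½ * w in
  (mid²≤½? : Dec (mid * mid ≤ ½)) →
  Brackets (if does mid²≤½? then mid else l) (½ * w)
brackets-step l w 0<w (lo , sq , up) (yes p) =
    ≤-trans lo (subst (_≤ l + ½ * w) (+-identityʳ l) (+-monoʳ-≤ l (<⇒≤ (0<½* 0<w))))
  , p
  , subst (λ r → ½ < r * r)
      (trans (cong (l +_) (sym (half w))) (sym (+-assoc l (½ * w) (½ * w)))) up
brackets-step l w 0<w (lo , sq , up) (no ¬p) = lo , sq , ≰⇒> ¬p

lower-bounds : ∀ n → Brackets (lower n) (width n)
lower-bounds zero = ≤-refl , toWitness {a? = ½ * ½ ≤? ½} _ , toWitness {a? = ½ <? 1ℚ} _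
lower-bounds (suc n) = brackets-step (lower n) (width n) (0<width n) (lower-bounds n)
  ((lower n + ½ * width n) * (lower n + ½ * width n) ≤? ½)

0≤lower : ∀ n → 0ℚ ≤ lower n
0≤lower n = ≤-trans (nonNegative⁻¹ ½) (proj₁ (lower-bounds n))

sq-mono : ∀ {p q} → 0ℚ ≤ p → p ≤ q → p * p ≤ q * q
sq-mono {p} {q} 0≤p p≤q = ≤-trans
  (*-monoˡ-≤-nonNeg p {{nonNegative 0≤p}} p≤q)
  (*-monoʳ-≤-nonNeg q {{nonNegative (≤-trans 0≤p p≤q)}} p≤q)

lower<upper : ∀ m n → lower m < lower n + width n
lower<upper m n with lower n + width n ≤? lower m
... | no  ¬p = ≰⇒> ¬p
... | yes p  = ⊥-elim (<-irrefl refl (<-≤-trans (proj₂ (proj₂ (lower-bounds n)))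
    (≤-trans (sq-mono 0≤up p) (proj₁ (proj₂ (lower-bounds m))))))
  where
  0≤up : 0ℚ ≤ lower n + width n
  0≤up = +-mono-≤ (0≤lower n) (<⇒≤ (0<width n))

lower≤1 : ∀ n → lower n ≤ 1ℚ
lower≤1 n = <⇒≤ (lower<upper n 0)

fromℕ : ℕ → ℚ
fromℕ n = mkℚ (pos n) 0 (Coprime.sym (Coprime.1-coprimeTo n))

fromℕ-suc : ∀ n → fromℕ (suc n) ≡ 1ℚ + fromℕ n
fromℕ-suc n = toℚᵘ-injective
  (ℚᵘ.≃-trans (ℚᵘ.*≡* eq) (ℚᵘ.≃-sym (toℚᵘ-homo-+ 1ℚ (fromℕ n))))
  where
  eq : pos (suc n) ℤ.* pos 1 ≡ (pos 1 ℤ.* pos 1 ℤ.+ pos n ℤ.* pos 1) ℤ.* pos 1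
  eq = cong (ℤ._* pos 1) (cong (λ k → pos 1 ℤ.+ k) (sym (ℤ.*-identityʳ (pos n))))

width≤1 : ∀ n → width n ≤ 1ℚ
width≤1 n = ≤-trans {width n} {½} {1ℚ}
  (width-antitone (ℕ.≤⇒≤′ (ℕ.z≤n {n}))) (toWitness {a? = ½ ≤? 1ℚ} _)

reciprocal-step : ∀ m w → m * w ≤ 1ℚ → w ≤ 1ℚ → (1ℚ + m) * (½ * w) ≤ 1ℚ
reciprocal-step m w p q = subst (_≤ 1ℚ) (sym (eq m w))
  (+-mono-≤ {½ * (m * w)} {½ * 1ℚ} {½ * w} {½ * 1ℚ}
    (*-monoˡ-≤-nonNeg ½ {m * w} {1ℚ} p) (*-monoˡ-≤-nonNeg ½ {w} {1ℚ} q))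
  where
  eq : ∀ m w → (1ℚ + m) * (½ * w) ≡ ½ * (m * w) + ½ * w
  eq = solve 2 (λ m w → ((con 1ℚ :+ m) :* (con ½ :* w)) := (con ½ :* (m :* w) :+ con ½ :* w)) refl

reciprocal-width : ∀ n → fromℕ (suc n) * width n ≤ 1ℚ
reciprocal-width zero = toWitness {a? = ½ ≤? 1ℚ} _
reciprocal-width (suc n) = subst (λ m → m * width (suc n) ≤ 1ℚ) (sym (fromℕ-suc (suc n)))
  (reciprocal-step (fromℕ (suc n)) (width n) (reciprocal-width n) (width≤1 n))

width-small : ∀ ε → 0ℚ < ε → ∃[ n ] width n < ε
width-small ε 0<ε = N , *-cancelˡ-<-nonNeg (fromℕ (suc N))
    (≤-<-trans (reciprocal-width N) (subst (_< fromℕ (suc N) * ε) (*-inverseˡ ε)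
      (*-monoˡ-<-pos ε (large (1/ ε) 0<1/ε))))
  where
  instance
    pos-ε : Positive ε
    pos-ε = positive 0<ε
    nz : ℚ.NonZero ε
    nz = pos⇒nonZero ε
  0<1/ε : 0ℚ < 1/ ε
  0<1/ε = positive⁻¹ (1/ ε) {{1/pos⇒pos ε}}
  N = ℤ.∣ ℚ.↥ (1/ ε) ∣
  large : ∀ q → 0ℚ < q → q < fromℕ (suc ℤ.∣ ℚ.↥ q ∣)
  large (mkℚ (pos a) d _) _ = ℚ.*<* (ℤ.≤-<-trans
    (ℤ.≤-reflexive (ℤ.*-identityʳ (pos a)))
    (ℤ.+<+ (ℕ.≤-trans ℕ.≤-refl (ℕ.m≤m*n (suc a) (suc d)))))
  large (mkℚ -[1+ a ] d _) (ℚ.*<* ())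

lower-near : ∀ {N m n} → N ℕ.≤ m → N ℕ.≤ n → lower m - lower n < width N
lower-near {N} {m} {n} p q = subst (lower m - lower n <_) (eq (lower n) (width N))
  (+-monoˡ-< (- lower n) (<-≤-trans (lower<upper m n)
    (+-monoʳ-≤ (lower n) (width-antitone (ℕ.≤⇒≤′ q)))))
  where
  eq : ∀ a b → a + b - a ≡ b
  eq = solve 2 (λ a b → (a :+ b :- a) := b) refl

abstract

  lower-cauchy : IsCauchy lower
  lower-cauchy ε 0<ε with width-small ε 0<ε
  ... | N , w<ε = N , λ m n p q → <-trans (near m n p q) w<ε
    where
    eq : ∀ a b → - (a - b) ≡ b - a
    eq = solve 2 (λ a b → (:- (a :- b)) := (b :- a)) refl
    near : ∀ m n → N ℕ.≤ m → N ℕ.≤ n → ∣ lower m - lower n ∣ < width N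
    near m n p q with ∣p∣≡p∨∣p∣≡-p (lower m - lower n)
    ... | inj₁ e = subst (_< width N) (sym e) (lower-near {N} {m} {n} p q)
    ... | inj₂ e = subst (_< width N) (sym (trans e (eq (lower m) (lower n))))
                     (lower-near {N} {n} {m} q p)

ρ : ℝ
ρ = mkℝ lower lower-cauchy

0<ρ : 0ᴿ <ᴿ ρ
0<ρ = ½ , positive⁻¹ ½ , 0 , λ n _ →
  subst (_≤ lower n) (sym (+-identityˡ ½)) (proj₁ (lower-bounds n))

square-gap : ∀ l w → Brackets l w → 0ℚ < w → l ≤ 1ℚ → w ≤ 1ℚ →
             ∣ l * l + l * l - 1ℚ ∣ < fromℕ 6 * w
square-gap l w (_ , sq , up) 0<w l≤1 w≤1 = subst (_< fromℕ 6 * w) (sym abs-eq)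
  (<-≤-trans {1ℚ - (l * l + l * l)} {u + u - (l * l + l * l)} {fromℕ 6 * w}
    (+-monoˡ-< (- (l * l + l * l)) {1ℚ} {u + u} (+-mono-< {½} {u} {½} {u} up up))
    (subst₂ _≤_ (sym (eq₂ l w)) (eq₃ w)
      (+-mono-≤ (+-mono-≤ (+-mono-≤ lw≤w lw≤w) (+-mono-≤ lw≤w lw≤w)) (+-mono-≤ ww≤w ww≤w))))
  where
  u : ℚ
  u = (l + w) * (l + w)
  eq₁ : ∀ s → - (s - 1ℚ) ≡ 1ℚ - s
  eq₁ = solve 1 (λ s → (:- (s :- con 1ℚ)) := (con 1ℚ :- s)) refl
  eq₂ : ∀ l w → (l + w) * (l + w) + (l + w) * (l + w) - (l * l + l * l)
              ≡ ((l * w + l * w) + (l * w + l * w)) + (w * w + w * w)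
  eq₂ = solve 2 (λ l w → ((l :+ w) :* (l :+ w) :+ (l :+ w) :* (l :+ w) :- (l :* l :+ l :* l))
              := (((l :* w :+ l :* w) :+ (l :* w :+ l :* w)) :+ (w :* w :+ w :* w))) refl
  eq₃ : ∀ w → ((w + w) + (w + w)) + (w + w) ≡ fromℕ 6 * w
  eq₃ = solve 1 (λ w → (((w :+ w) :+ (w :+ w)) :+ (w :+ w)) := (con (fromℕ 6) :* w)) refl
  nonpos : l * l + l * l - 1ℚ ≤ 0ℚ
  nonpos = +-monoˡ-≤ (- 1ℚ) {l * l + l * l} {1ℚ} (+-mono-≤ {l * l} {½} {l * l} {½} sq sq)
  abs-eq : ∣ l * l + l * l - 1ℚ ∣ ≡ 1ℚ - (l * l + l * l)
  abs-eq = trans (sym (∣-p∣≡∣p∣ (l * l + l * l - 1ℚ)))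
             (trans (0≤p⇒∣p∣≡p (neg-antimono-≤ nonpos)) (eq₁ (l * l + l * l)))
  lw≤w : l * w ≤ w
  lw≤w = subst (l * w ≤_) (*-identityˡ w) (*-monoʳ-≤-nonNeg w {{nonNegative (<⇒≤ 0<w)}} l≤1)
  ww≤w : w * w ≤ w
  ww≤w = subst (w * w ≤_) (*-identityˡ w) (*-monoʳ-≤-nonNeg w {{nonNegative (<⇒≤ 0<w)}} w≤1)

ρ²+ρ²≈1 : ρ *ᴿ ρ +ᴿ ρ *ᴿ ρ ≈ᴿ 1ᴿ
ρ²+ρ²≈1 ε 0<ε = N , λ n N≤n →
  <-trans (square-gap (lower n) (width n) (lower-bounds n) (0<width n) (lower≤1 n) (width≤1 n))
    (≤-<-trans (*-monoˡ-≤-nonNeg (fromℕ 6) {width n} {width N} (width-antitone (ℕ.≤⇒≤′ N≤n)))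
      (subst (fromℕ 6 * width N <_) 6δ≡ε (*-monoʳ-<-pos (fromℕ 6) {width N} {δ} width<δ)))
  where
  δ : ℚ
  δ = 1/ (fromℕ 6) * ε
  0<δ : 0ℚ < δ
  0<δ = subst (_< δ) (*-zeroʳ (1/ (fromℕ 6))) (*-monoʳ-<-pos (1/ (fromℕ 6)) 0<ε)
  N : ℕ
  N = proj₁ (width-small δ 0<δ)
  width<δ : width N < δ
  width<δ = proj₂ (width-small δ 0<δ)
  6δ≡ε : fromℕ 6 * δ ≡ ε
  6δ≡ε = trans (sym (*-assoc (fromℕ 6) (1/ (fromℕ 6)) ε)) (*-identityˡ ε)

infix 4 _+i_

record ℂ : Set where
  constructor _+i_
  field
    re im : ℝ

open ℂ public

ℂ-rawRing : RawRing 0ℓ 0ℓ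
ℂ-rawRing = record
  { Carrier = ℂ
  ; _≈_ = λ z w → re z ≈ᴿ re w × im z ≈ᴿ im w
  ; _+_ = λ z w → re z +ᴿ re w +i im z +ᴿ im w
  ; _*_ = λ z w → re z *ᴿ re w +ᴿ -ᴿ (im z *ᴿ im w) +i re z *ᴿ im w +ᴿ im z *ᴿ re w
  ; -_  = λ z → -ᴿ re z +i -ᴿ im z
  ; 0#  = 0ᴿ +i 0ᴿ
  ; 1#  = 1ᴿ +i 0ᴿ
  }

open RawRing ℂ-rawRing public using () renaming
  ( _≈_ to infix 4 _≈ᶜ_ ; _+_ to infixl 6 _+ᶜ_ ; _*_ to infixl 7 _*ᶜ_ ; -_ to infix 8 -ᶜ_
  ; 0# to 0ᶜ ; 1# to 1ᶜ ; rawSemiring to ℂ-rawSemiring )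

open RawSemiringDefs ℂ-rawSemiring public using (sum) renaming (_^_ to infixr 8 _^ᶜ_)

real : ℝ → ℂ
real x = x +i 0ᴿ

conj : ℂ → ℂ
conj z = re z +i -ᴿ im z

∣_∣² : ℂ → ℝ
∣ z ∣² = re z *ᴿ re z +ᴿ im z *ᴿ im z

-- ε-N convergence; |s n - c| < ε is written with both sides squared.
infix 4 _⟶_
_⟶_ : (ℕ → ℂ) → ℂ → Set
s ⟶ c = ∀ ε → 0ℚ < ε → ∃[ N ] ∀ n → N ℕ.≤ n → ∣ s n +ᶜ -ᶜ c ∣² <ᴿ fromℚ (ε * ε)

reciprocal! : ℕ → ℚ
reciprocal! k = (pos 1 ℚ./ (k !)) {{k ℕ.!≢0}}

-- IsExp z c: c is the sum of the exponential series ∑ zᵏ / k!.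
IsExp : ℂ → ℂ → Set
IsExp z c = (λ n → sum {n} λ k → real (fromℚ (reciprocal! (toℕ k))) *ᶜ z ^ᶜ toℕ k) ⟶ c

ℂ^ : ℕ → Set
ℂ^ n = Vector ℂ n

-- Conjugate-linear in the first argument.
⟨_,_⟩ : ∀ {n} → ℂ^ n → ℂ^ n → ℂ
⟨ u , v ⟩ = sum λ k → conj (u k) *ᶜ v k

IsUnit : ∀ {n} → ℂ^ n → Set
IsUnit v = ⟨ v , v ⟩ ≈ᶜ 1ᶜ

module _ {m n} (v : Vector (ℂ^ n) m) where

  combination : Vector ℂ m → ℂ^ n
  combination c k = sum λ i → c i *ᶜ v i k

  LinearlyIndependent : Set
  LinearlyIndependent = (c : Vector ℂ m) → (∀ k → combination c k ≈ᶜ 0ᶜ) → ∀ i → c i ≈ᶜ 0ᶜ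

  Spanning : Set
  Spanning = (w : ℂ^ n) → Σ[ c ∈ Vector ℂ m ] ∀ k → w k ≈ᶜ combination c k

  record IsOrthonormalBasis : Set where
    field
      unit        : ∀ i → IsUnit (v i)
      orthogonal  : ∀ i j → i ≢ j → ⟨ v i , v j ⟩ ≈ᶜ 0ᶜ
      independent : LinearlyIndependent
      spanning    : Spanning

-- c is the scalar e^{iα}.
PhaseEquivalent : ∀ {n} → ℂ^ n → ℂ^ n → Set
PhaseEquivalent u v =
  ∃[ α ] ∃[ c ] IsExp (0ᴿ +i α) c × (∀ k → u k ≈ᶜ c *ᶜ v k)

Square : ℕ → Set
Square n = Fin n → Fin n → ℂ^ n

record IsQuantumLatinSquare {n} (Q : Square n) : Set where
  field
    unit    : ∀ i j → IsUnit (Q i j)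
    rows    : ∀ i → IsOrthonormalBasis (λ j → Q i j)
    columns : ∀ j → IsOrthonormalBasis (λ i → Q i j)

-- The phase-equivalence classes of the n² entries are in bijection with Fin k:
-- f picks exactly one cell from each class.
HasCardinality : ∀ {n} → Square n → ℕ → Set
HasCardinality {n} Q k = Σ[ f ∈ (Fin k → Fin n × Fin n) ]
  Bijective _≡_ (λ (i , j) (i′ , j′) → PhaseEquivalent (Q i j) (Q i′ j′)) f

Φ : (a b : ℝ) → 0ᴿ <ᴿ a → 0ᴿ <ᴿ b → a *ᴿ a +ᴿ b *ᴿ b ≈ᴿ 1ᴿ → Square 6
Φ a b _ _ _ =
  ( (x ∷ A ∷ y ∷ B ∷ C ∷ D ∷ [])
  ∷ (y ∷ x ∷ E ∷ F ∷ G ∷ H ∷ [])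
  ∷ (I ∷ y ∷ x ∷ J ∷ K ∷ L ∷ [])
  ∷ (M ∷ D ∷ N ∷ z ∷ O ∷ w ∷ [])
  ∷ (P ∷ C ∷ Q ∷ w ∷ z ∷ R ∷ [])
  ∷ (T ∷ B ∷ U ∷ S ∷ w ∷ z ∷ [])
  ∷ [] )
  where
  𝒰 : (t₀ t₁ t₂ t₃ : ℝ) → ℂ^ 6
  𝒰 t₀ t₁ t₂ t₃ = real t₀ ∷ real t₁ ∷ real t₂ ∷ real t₃ ∷ 0ᶜ ∷ 0ᶜ ∷ []

  𝒱 : (t₄ t₅ : ℝ) → ℂ^ 6
  𝒱 t₄ t₅ = 0ᶜ ∷ 0ᶜ ∷ 0ᶜ ∷ 0ᶜ ∷ real t₄ ∷ real t₅ ∷ []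

  aρ bρ : ℝ
  aρ = a *ᴿ ρ
  bρ = b *ᴿ ρ

  A B C D E F G H I J K L M N O P Q R S T U x y z w : ℂ^ 6
  A = 𝒰 1ᴿ 0ᴿ 0ᴿ 0ᴿ
  B = 𝒰 0ᴿ 1ᴿ 0ᴿ 0ᴿ
  C = 𝒰 0ᴿ 0ᴿ 1ᴿ 0ᴿ
  D = 𝒰 0ᴿ 0ᴿ 0ᴿ 1ᴿ
  E = 𝒰 0ᴿ a bρ bρ
  F = 𝒰 a 0ᴿ bρ (-ᴿ bρ)
  G = 𝒰 bρ (-ᴿ bρ) 0ᴿ a
  H = 𝒰 (-ᴿ bρ) (-ᴿ bρ) a 0ᴿ
  I = 𝒰 0ᴿ (-ᴿ b) aρ aρ
  J = 𝒰 (-ᴿ b) 0ᴿ aρ (-ᴿ aρ)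
  K = 𝒰 (-ᴿ aρ) aρ 0ᴿ b
  L = 𝒰 aρ aρ b 0ᴿ
  M = 𝒰 (-ᴿ aρ) aρ b 0ᴿ
  N = 𝒰 bρ (-ᴿ bρ) a 0ᴿ
  O = 𝒰 ρ ρ 0ᴿ 0ᴿ
  P = 𝒰 aρ aρ 0ᴿ b
  Q = 𝒰 (-ᴿ bρ) (-ᴿ bρ) 0ᴿ a
  R = 𝒰 (-ᴿ ρ) ρ 0ᴿ 0ᴿ
  S = 𝒰 0ᴿ 0ᴿ ρ ρ
  T = 𝒰 b 0ᴿ aρ (-ᴿ aρ)
  U = 𝒰 (-ᴿ a) 0ᴿ bρ (-ᴿ bρ)
  x = 𝒱 1ᴿ 0ᴿ
  y = 𝒱 0ᴿ 1ᴿ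
  z = 𝒱 ρ ρ
  w = 𝒱 ρ (-ᴿ ρ)

Φ₂₃ : Square 6
Φ₂₃ = Φ ρ ρ 0<ρ 0<ρ ρ²+ρ²≈1

{-# OPTIONS --safe #-}

-- At a = b = ρ all components of the vectors lie in ℚ(ρ), where ρ² = 1/2. Hence orthonormality of
-- every row and column, and of its transpose, is an exact computation with pairs of rationals.
-- Orthonormality of a family gives linear independence, and orthonormality of its transpose
-- gives the spanning property. Proportional vectors have vanishing 2 × 2 minors, and a nonzero norm
-- from ℚ(ρ) to ℚ shows a minor to be nonzero; this separates the 23 classes. Conversely T = F and
-- U = J, and equal vectors are phase equivalent through e^{i0} = 1.

module Submission where

open import Algebra.Bundles using (CommutativeRing)
import Algebra.Properties.CommutativeMonoid.Sum as CommutativeMonoidSum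
import Algebra.Properties.CommutativeSemigroup as CommutativeSemigroupProperties
import Algebra.Properties.Semiring.Sum as SemiringSum
open import Data.Empty using (⊥-elim)
open import Data.Fin.Base using (Fin; zero; suc; toℕ; punchIn)
open import Data.Fin.Patterns using (0F; 1F; 2F; 3F; 4F; 5F)
open import Data.Fin.Properties using (all?; any?; punchInᵢ≢i) renaming (_≟_ to _≟ᶠ_)
open import Data.Nat.Base as ℕ using (ℕ; _⊔_)
import Data.Nat.Properties as ℕ
open import Data.Product.Base using (_×_; _,_; proj₁; proj₂; ∃-syntax)
open import Data.Product.Properties using (≡-dec)
open import Data.Vec.Base using (lookup; tabulate)
open import Data.Vec.Functional using (Vector; []; _∷_; foldr; removeAt)
open import Data.Vec.Properties using (lookup∘tabulate)
open import Function.Base using (_∘_; flip)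
open import Level using (0ℓ)
open import Relation.Binary.PropositionalEquality
  using (_≡_; _≢_; ≢-sym; refl; sym; trans; cong; subst; subst₂)
import Relation.Binary.Reasoning.Setoid as SetoidReasoning
open import Relation.Nullary.Decidable using (Dec; yes; no; from-yes; ¬?; _→-dec_; _×-dec_)

-- Dual families and minors over a commutative ring.

module LinearAlgebra {c ℓ} (R : CommutativeRing c ℓ) where

  open CommutativeRing R renaming (sym to ≈-sym; trans to ≈-trans; refl to ≈-refl)
  open CommutativeMonoidSum +-commutativeMonoid
    using (sum; sum-cong-≋; sum-replicate-zero; sum-remove; ∑-comm)
  open SemiringSum semiring using (*-distribˡ-sum; *-distribʳ-sum)
  open CommutativeSemigroupProperties *-commutativeSemigroup using (x∙yz≈y∙xz; xy∙z≈xz∙y)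
  open SetoidReasoning setoid

  sum-zero : ∀ {n} {f : Vector Carrier n} → (∀ i → f i ≈ 0#) → sum f ≈ 0#
  sum-zero {n} f≈0 = ≈-trans (sum-cong-≋ f≈0) (sum-replicate-zero n)

  sum-supported : ∀ {n} (f : Vector Carrier n) i → (∀ j → j ≢ i → f j ≈ 0#) → sum f ≈ f i
  sum-supported {ℕ.suc n} f i off = begin
    sum f                      ≈⟨ sum-remove {i = i} f ⟩
    f i + sum (removeAt f i)   ≈⟨ +-congˡ (sum-zero λ j → off (punchIn i j) (punchInᵢ≢i i j)) ⟩
    f i + 0#                   ≈⟨ +-identityʳ (f i) ⟩
    f i                        ∎

  sum-indicator : ∀ {n} (f g : Vector Carrier n) i → g i ≈ 1# → (∀ j → j ≢ i → g j ≈ 0#) →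
                  sum (λ j → f j * g j) ≈ f i
  sum-indicator f g i on off = begin
    sum (λ j → f j * g j)
      ≈⟨ sum-supported _ i (λ j j≢i → ≈-trans (*-congˡ (off j j≢i)) (zeroʳ (f j))) ⟩
    f i * g i  ≈⟨ *-congˡ on ⟩
    f i * 1#   ≈⟨ *-identityʳ (f i) ⟩
    f i        ∎

  infix 8 _∙_

  _∙_ : ∀ {n} → Vector Carrier n → Vector Carrier n → Carrier
  u ∙ v = sum λ k → u k * v k

  -- The pairing `_∙_` is bilinear, so the argument needs only ring laws; over ℂ the family `u` will
  -- be the entrywise conjugate of `v`.
  Dual : ∀ {m n} → Vector (Vector Carrier n) m → Vector (Vector Carrier n) m → Set ℓ
  Dual u v = (∀ i → u i ∙ v i ≈ 1#) × (∀ i j → i ≢ j → u i ∙ v j ≈ 0#)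

  -- Pairing the combination `∑ a j v j` with `u i` extracts the coefficient `a i`; exchanging the
  -- two finite sums then shows it to be zero.
  dual⇒independent : ∀ {m n} (u v : Vector (Vector Carrier n) m) → Dual u v →
    (a : Vector Carrier m) → (∀ k → sum (λ i → a i * v i k) ≈ 0#) → ∀ i → a i ≈ 0#
  dual⇒independent {m} {n} u v (on , off) a a∙v≈0 i = begin
    a i
      ≈⟨ sum-indicator a (λ j → u i ∙ v j) i (on i) (λ j j≢i → off i j (≢-sym j≢i)) ⟨
    sum (λ j → a j * u i ∙ v j)
      ≈⟨ sum-cong-≋ (λ j → *-distribˡ-sum {n} (a j) _) ⟩
    sum (λ j → sum λ k → a j * (u i k * v j k))
      ≈⟨ ∑-comm {m} {n} _ ⟩
    sum (λ k → sum λ j → a j * (u i k * v j k))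
      ≈⟨ sum-cong-≋ (λ k → sum-cong-≋ λ j → x∙yz≈y∙xz (a j) (u i k) (v j k)) ⟩
    sum (λ k → sum λ j → u i k * (a j * v j k))
      ≈⟨ sum-cong-≋ (λ k → *-distribˡ-sum {m} (u i k) _) ⟨
    sum (λ k → u i k * sum λ j → a j * v j k)
      ≈⟨ sum-zero (λ k → ≈-trans (*-congˡ (a∙v≈0 k)) (zeroʳ (u i k))) ⟩
    0# ∎

  -- The transposed relations say that `∑ u i l * v i k` is the Kronecker delta in `l` and `k`, a
  -- resolution of the identity. Applied to `w`, it yields explicit coefficients in place of a
  -- dimension argument.
  dualᵀ⇒spanning : ∀ {m n} (u v : Vector (Vector Carrier n) m) →
    Dual (λ k i → u i k) (λ k i → v i k) →
    ∀ w k → w k ≈ sum (λ i → w ∙ u i * v i k)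
  dualᵀ⇒spanning {m} {n} u v (on , off) w k = begin
    w k
      ≈⟨ sum-indicator w (λ l → (λ i → u i l) ∙ (λ i → v i k)) k (on k) (λ l → off l k) ⟨
    sum (λ l → w l * sum λ i → u i l * v i k)
      ≈⟨ sum-cong-≋ (λ l → *-distribˡ-sum {m} (w l) _) ⟩
    sum (λ l → sum λ i → w l * (u i l * v i k))
      ≈⟨ ∑-comm {n} {m} _ ⟩
    sum (λ i → sum λ l → w l * (u i l * v i k))
      ≈⟨ sum-cong-≋ (λ i → sum-cong-≋ λ l → *-assoc (w l) (u i l) (v i k)) ⟨
    sum (λ i → sum λ l → w l * u i l * v i k)
      ≈⟨ sum-cong-≋ (λ i → *-distribʳ-sum {n} (v i k) _) ⟨
    sum (λ i → w ∙ u i * v i k) ∎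

  parallel⇒minors-vanish : ∀ {n} (u v : Vector Carrier n) a → (∀ k → u k ≈ a * v k) →
                           ∀ k l → u k * v l ≈ u l * v k
  parallel⇒minors-vanish u v a u≈av k l = begin
    u k * v l        ≈⟨ *-congʳ (u≈av k) ⟩
    a * v k * v l    ≈⟨ xy∙z≈xz∙y a (v k) (v l) ⟩
    a * v l * v k    ≈⟨ *-congʳ (u≈av l) ⟨
    u l * v k        ∎

open import Defs
open import Data.Rational.Base
  using (ℚ; 0ℚ; 1ℚ; ½; ∣_∣; _+_; _*_; _-_; -_; _<_; _≤_; positive)
open import Data.Rational.Properties
open import Data.Rational.Solver using (module +-*-Solver)

open +-*-Solver using (Polynomial; solve; _:+_; _:*_; _:-_; :-_; _:=_; con)

-- Null sequences and the congruence laws of ℝ.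

Null : (ℕ → ℚ) → Set
Null u = ∀ ε → 0ℚ < ε → ∃[ N ] ∀ n → N ℕ.≤ n → ∣ u n ∣ < ε

-- Cauchy sequences are bounded, so as coefficients they preserve null sequences. Each estimate on
-- reals below thereby reduces to a polynomial identity over ℚ that writes one difference through
-- two others.
null-linear : ∀ x y {u v w} → Null u → Null v →
              (∀ n → seq x n * u n + seq y n * v n ≡ w n) → Null w
null-linear x y {u} {v} nu nv eq ε 0<ε =
  let B , 0<B , K , hB = bounded {seq x} (cauchy x)
      C , 0<C , L , hC = bounded {seq y} (cauchy y)
      δ , 0<δ , δ-eq   = scale 0<B 0<C 0<ε
      M , hM           = nu δ 0<δ
      N , hN           = nv δ 0<δ
  in (K ⊔ L) ⊔ (M ⊔ N) , λ n p →
  let p₁ = ℕ.m⊔n≤o⇒m≤o (K ⊔ L) (M ⊔ N) p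
      p₂ = ℕ.m⊔n≤o⇒n≤o (K ⊔ L) (M ⊔ N) p
  in subst₂ (λ r s → ∣ r ∣ < s) (eq n) δ-eq
       (≤-<-trans (∣p+q∣≤∣p∣+∣q∣ (seq x n * u n) (seq y n * v n))
         (+-mono-<
           (*-bound (seq x n) (u n) 0<B (hB n (ℕ.m⊔n≤o⇒m≤o K L p₁)) (hM n (ℕ.m⊔n≤o⇒m≤o M N p₂)))
           (*-bound (seq y n) (v n) 0<C (hC n (ℕ.m⊔n≤o⇒n≤o K L p₁)) (hN n (ℕ.m⊔n≤o⇒n≤o M N p₂)))))

≈ᴿ-pointwise : ∀ x y → (∀ n → seq x n ≡ seq y n) → x ≈ᴿ y
≈ᴿ-pointwise x y eq ε 0<ε =
  0 , λ n _ → subst (λ r → ∣ r - seq y n ∣ < ε) (sym (eq n)) (∣0∣< (seq y n) 0<ε)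

≈ᴿ-refl : ∀ x → x ≈ᴿ x
≈ᴿ-refl x = ≈ᴿ-pointwise x x λ _ → refl

≈ᴿ-sym : ∀ x y → x ≈ᴿ y → y ≈ᴿ x
-- A single null sequence suffices here, so the second coefficient is `0ᴿ`.
≈ᴿ-sym x y p = null-linear (-ᴿ 1ᴿ) 0ᴿ p p
  λ n → eq (seq x n) (seq y n)
  where
  eq : ∀ a b → - 1ℚ * (a - b) + 0ℚ * (a - b) ≡ b - a
  eq = solve 2 (λ a b → con (- 1ℚ) :* (a :- b) :+ con 0ℚ :* (a :- b) := b :- a) refl

≈ᴿ-trans : ∀ x y z → x ≈ᴿ y → y ≈ᴿ z → x ≈ᴿ z
≈ᴿ-trans x y z p q = null-linear 1ᴿ 1ᴿ p q
  λ n → eq (seq x n) (seq y n) (seq z n)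
  where
  eq : ∀ a b c → 1ℚ * (a - b) + 1ℚ * (b - c) ≡ a - c
  eq = solve 3 (λ a b c → con 1ℚ :* (a :- b) :+ con 1ℚ :* (b :- c) := a :- c) refl

+ᴿ-cong : ∀ x y u v → x ≈ᴿ y → u ≈ᴿ v → x +ᴿ u ≈ᴿ y +ᴿ v
+ᴿ-cong x y u v p q = null-linear 1ᴿ 1ᴿ p q
  λ n → eq (seq x n) (seq y n) (seq u n) (seq v n)
  where
  eq : ∀ a b c d → 1ℚ * (a - b) + 1ℚ * (c - d) ≡ a + c - (b + d)
  eq = solve 4 (λ a b c d →
    con 1ℚ :* (a :- b) :+ con 1ℚ :* (c :- d) := a :+ c :- (b :+ d)) refl

-- The identity is `x u - y v = x (u - v) + v (x - y)`, with `x` and `v` as the bounded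
-- coefficients.
*ᴿ-cong : ∀ x y u v → x ≈ᴿ y → u ≈ᴿ v → x *ᴿ u ≈ᴿ y *ᴿ v
*ᴿ-cong x y u v p q = null-linear x v q p
  λ n → *-diff (seq x n) (seq y n) (seq u n) (seq v n)

-ᴿ-cong : ∀ x y → x ≈ᴿ y → -ᴿ x ≈ᴿ -ᴿ y
-ᴿ-cong x y p = null-linear (-ᴿ 1ᴿ) 0ᴿ p p
  λ n → eq (seq x n) (seq y n)
  where
  eq : ∀ a b → - 1ℚ * (a - b) + 0ℚ * (a - b) ≡ - a - - b
  eq = solve 2 (λ a b → con (- 1ℚ) :* (a :- b) :+ con 0ℚ :* (a :- b) := :- a :- :- b) refl

-- ℂ as a commutative ring.

≈ᶜ-pointwise : ∀ z w → (∀ n → seq (re z) n ≡ seq (re w) n) →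
               (∀ n → seq (im z) n ≡ seq (im w) n) → z ≈ᶜ w
≈ᶜ-pointwise z w p q = ≈ᴿ-pointwise (re z) (re w) p , ≈ᴿ-pointwise (im z) (im w) q

-- Complex arithmetic on pairs (real part, imaginary part) of solver polynomials.

infixl 7 _⊗_

_⊗_ : ∀ {n} → Polynomial n × Polynomial n → Polynomial n × Polynomial n →
      Polynomial n × Polynomial n
(a , b) ⊗ (c , d) = a :* c :+ :- (b :* d) , a :* d :+ b :* c

infixl 6 _⊕_

_⊕_ : ∀ {n} → Polynomial n × Polynomial n → Polynomial n × Polynomial n →
      Polynomial n × Polynomial n
(a , b) ⊕ (c , d) = a :+ c , b :+ d

*ᶜ-comm : ∀ z w → z *ᶜ w ≈ᶜ w *ᶜ z
*ᶜ-comm z w = ≈ᶜ-pointwise (z *ᶜ w) (w *ᶜ z)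
  (λ n → solve 4 (λ a b c d → proj₁ ((a , b) ⊗ (c , d)) := proj₁ ((c , d) ⊗ (a , b))) refl
    (seq (re z) n) (seq (im z) n) (seq (re w) n) (seq (im w) n))
  (λ n → solve 4 (λ a b c d → proj₂ ((a , b) ⊗ (c , d)) := proj₂ ((c , d) ⊗ (a , b))) refl
    (seq (re z) n) (seq (im z) n) (seq (re w) n) (seq (im w) n))

*ᶜ-assoc : ∀ x y z → x *ᶜ y *ᶜ z ≈ᶜ x *ᶜ (y *ᶜ z)
*ᶜ-assoc x y z = ≈ᶜ-pointwise (x *ᶜ y *ᶜ z) (x *ᶜ (y *ᶜ z))
  (λ n → solve 6 (λ a b c d e f →
      proj₁ ((a , b) ⊗ (c , d) ⊗ (e , f)) := proj₁ ((a , b) ⊗ ((c , d) ⊗ (e , f)))) refl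
    (seq (re x) n) (seq (im x) n) (seq (re y) n) (seq (im y) n) (seq (re z) n) (seq (im z) n))
  (λ n → solve 6 (λ a b c d e f →
      proj₂ ((a , b) ⊗ (c , d) ⊗ (e , f)) := proj₂ ((a , b) ⊗ ((c , d) ⊗ (e , f)))) refl
    (seq (re x) n) (seq (im x) n) (seq (re y) n) (seq (im y) n) (seq (re z) n) (seq (im z) n))

*ᶜ-distribˡ-+ᶜ : ∀ x y z → x *ᶜ (y +ᶜ z) ≈ᶜ x *ᶜ y +ᶜ x *ᶜ z
*ᶜ-distribˡ-+ᶜ x y z = ≈ᶜ-pointwise (x *ᶜ (y +ᶜ z)) (x *ᶜ y +ᶜ x *ᶜ z)
  (λ n → solve 6 (λ a b c d e f →
      proj₁ ((a , b) ⊗ ((c , d) ⊕ (e , f))) := proj₁ ((a , b) ⊗ (c , d) ⊕ (a , b) ⊗ (e , f))) refl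
    (seq (re x) n) (seq (im x) n) (seq (re y) n) (seq (im y) n) (seq (re z) n) (seq (im z) n))
  (λ n → solve 6 (λ a b c d e f →
      proj₂ ((a , b) ⊗ ((c , d) ⊕ (e , f))) := proj₂ ((a , b) ⊗ (c , d) ⊕ (a , b) ⊗ (e , f))) refl
    (seq (re x) n) (seq (im x) n) (seq (re y) n) (seq (im y) n) (seq (re z) n) (seq (im z) n))

*ᶜ-distribʳ-+ᶜ : ∀ x y z → (y +ᶜ z) *ᶜ x ≈ᶜ y *ᶜ x +ᶜ z *ᶜ x
*ᶜ-distribʳ-+ᶜ x y z = ≈ᶜ-pointwise ((y +ᶜ z) *ᶜ x) (y *ᶜ x +ᶜ z *ᶜ x)
  (λ n → solve 6 (λ a b c d e f →
      proj₁ (((c , d) ⊕ (e , f)) ⊗ (a , b)) := proj₁ ((c , d) ⊗ (a , b) ⊕ (e , f) ⊗ (a , b))) refl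
    (seq (re x) n) (seq (im x) n) (seq (re y) n) (seq (im y) n) (seq (re z) n) (seq (im z) n))
  (λ n → solve 6 (λ a b c d e f →
      proj₂ (((c , d) ⊕ (e , f)) ⊗ (a , b)) := proj₂ ((c , d) ⊗ (a , b) ⊕ (e , f) ⊗ (a , b))) refl
    (seq (re x) n) (seq (im x) n) (seq (re y) n) (seq (im y) n) (seq (re z) n) (seq (im z) n))

*ᶜ-identityˡ : ∀ z → 1ᶜ *ᶜ z ≈ᶜ z
*ᶜ-identityˡ z = ≈ᶜ-pointwise (1ᶜ *ᶜ z) z
  (λ n → solve 2 (λ a b → proj₁ ((con 1ℚ , con 0ℚ) ⊗ (a , b)) := a) refl
    (seq (re z) n) (seq (im z) n))
  (λ n → solve 2 (λ a b → proj₂ ((con 1ℚ , con 0ℚ) ⊗ (a , b)) := b) refl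
    (seq (re z) n) (seq (im z) n))

*ᶜ-identityʳ : ∀ z → z *ᶜ 1ᶜ ≈ᶜ z
*ᶜ-identityʳ z = ≈ᶜ-pointwise (z *ᶜ 1ᶜ) z
  (λ n → solve 2 (λ a b → proj₁ ((a , b) ⊗ (con 1ℚ , con 0ℚ)) := a) refl
    (seq (re z) n) (seq (im z) n))
  (λ n → solve 2 (λ a b → proj₂ ((a , b) ⊗ (con 1ℚ , con 0ℚ)) := b) refl
    (seq (re z) n) (seq (im z) n))

-- The operations are literally those of `ℂ-rawRing`, so `sum` and `⟨_,_⟩` agree by definition with
-- the sums and pairings of `LinearAlgebra`.
ℂ-commutativeRing : CommutativeRing 0ℓ 0ℓ
ℂ-commutativeRing = record
  { Carrier = ℂ
  ; _≈_ = _≈ᶜ_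
  ; _+_ = _+ᶜ_
  ; _*_ = _*ᶜ_
  ; -_  = -ᶜ_
  ; 0#  = 0ᶜ
  ; 1#  = 1ᶜ
  ; isCommutativeRing = record
    { isRing = record
      { +-isAbelianGroup = record
        { isGroup = record
          { isMonoid = record
            { isSemigroup = record
              { isMagma = record
                { isEquivalence = record
                  { refl  = λ {z} → ≈ᴿ-refl (re z) , ≈ᴿ-refl (im z)
                  ; sym   = λ {z} {w} (p , q) →
                      ≈ᴿ-sym (re z) (re w) p , ≈ᴿ-sym (im z) (im w) q
                  ; trans = λ {x} {y} {z} (p , q) (p′ , q′) →
                      ≈ᴿ-trans (re x) (re y) (re z) p p′ , ≈ᴿ-trans (im x) (im y) (im z) q q′
                  }
                ; ∙-cong = λ {x} {y} {u} {v} (p , q) (p′ , q′) →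
                    +ᴿ-cong (re x) (re y) (re u) (re v) p p′
                  , +ᴿ-cong (im x) (im y) (im u) (im v) q q′
                }
              ; assoc = λ x y z → ≈ᶜ-pointwise (x +ᶜ y +ᶜ z) (x +ᶜ (y +ᶜ z))
                  (λ n → +-assoc (seq (re x) n) (seq (re y) n) (seq (re z) n))
                  (λ n → +-assoc (seq (im x) n) (seq (im y) n) (seq (im z) n))
              }
            ; identity =
                (λ z → ≈ᶜ-pointwise (0ᶜ +ᶜ z) z
                  (λ n → +-identityˡ (seq (re z) n)) (λ n → +-identityˡ (seq (im z) n)))
              , (λ z → ≈ᶜ-pointwise (z +ᶜ 0ᶜ) z
                  (λ n → +-identityʳ (seq (re z) n)) (λ n → +-identityʳ (seq (im z) n)))
            }
          ; inverse =
              (λ z → ≈ᶜ-pointwise (-ᶜ z +ᶜ z) 0ᶜ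
                (λ n → +-inverseˡ (seq (re z) n)) (λ n → +-inverseˡ (seq (im z) n)))
            , (λ z → ≈ᶜ-pointwise (z +ᶜ -ᶜ z) 0ᶜ
                (λ n → +-inverseʳ (seq (re z) n)) (λ n → +-inverseʳ (seq (im z) n)))
          ; ⁻¹-cong = λ {z} {w} (p , q) →
              -ᴿ-cong (re z) (re w) p , -ᴿ-cong (im z) (im w) q
          }
        ; comm = λ z w → ≈ᶜ-pointwise (z +ᶜ w) (w +ᶜ z)
            (λ n → +-comm (seq (re z) n) (seq (re w) n))
            (λ n → +-comm (seq (im z) n) (seq (im w) n))
        }
      ; *-cong = λ {x} {y} {u} {v} (p , q) (p′ , q′) →
          +ᴿ-cong (re x *ᴿ re u) (re y *ᴿ re v) (-ᴿ (im x *ᴿ im u)) (-ᴿ (im y *ᴿ im v))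
            (*ᴿ-cong (re x) (re y) (re u) (re v) p p′)
            (-ᴿ-cong (im x *ᴿ im u) (im y *ᴿ im v) (*ᴿ-cong (im x) (im y) (im u) (im v) q q′))
        , +ᴿ-cong (re x *ᴿ im u) (re y *ᴿ im v) (im x *ᴿ re u) (im y *ᴿ re v)
            (*ᴿ-cong (re x) (re y) (im u) (im v) p q′)
            (*ᴿ-cong (im x) (im y) (re u) (re v) q p′)
      ; *-assoc = *ᶜ-assoc
      ; *-identity = *ᶜ-identityˡ , *ᶜ-identityʳ
      ; distrib = *ᶜ-distribˡ-+ᶜ , *ᶜ-distribʳ-+ᶜ
      }
    ; *-comm = *ᶜ-comm
    }
  }

-- Exact arithmetic in ℚ(ρ) and the entries of the array.

-- (p , q) stands for p + q ρ.
ℚ[ρ] : Set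
ℚ[ρ] = ℚ × ℚ

infixl 6 _+′_ _-′_
infixl 7 _*′_
infix 4 _≟′_

_+′_ _-′_ _*′_ : ℚ[ρ] → ℚ[ρ] → ℚ[ρ]
(p , q) +′ (p′ , q′) = p + p′ , q + q′
(p , q) -′ (p′ , q′) = p - p′ , q - q′
(p , q) *′ (p′ , q′) = p * p′ + ½ * (q * q′) , p * q′ + q * p′

-′_ : ℚ[ρ] → ℚ[ρ]
-′ (p , q) = - p , - q

-- The field norm `(p + q ρ) (p - q ρ)`, evaluated with `ρ² = ½`.
norm : ℚ[ρ] → ℚ
norm (p , q) = p * p - ½ * (q * q)

_≟′_ : (s t : ℚ[ρ]) → Dec (s ≡ t)
_≟′_ = ≡-dec _≟_ _≟_

sum′ : ∀ {n} → Vector ℚ[ρ] n → ℚ[ρ]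
sum′ = foldr _+′_ (0ℚ , 0ℚ)

infix 8 -ᵉ_
infixl 7 _*ᵉ_

-- Equality of Cauchy reals cannot be decided by evaluation. One syntax with two evaluations links
-- the entries as real numbers to pairs of rationals, which can be compared.
data Expr : Set where
  0ᵉ 1ᵉ ρᵉ : Expr
  _*ᵉ_     : Expr → Expr → Expr
  -ᵉ_      : Expr → Expr

evalᴿ : Expr → ℝ
evalᴿ 0ᵉ       = 0ᴿ
evalᴿ 1ᵉ       = 1ᴿ
evalᴿ ρᵉ       = ρ
evalᴿ (d *ᵉ e) = evalᴿ d *ᴿ evalᴿ e
evalᴿ (-ᵉ e)   = -ᴿ evalᴿ e

eval : Expr → ℚ[ρ]
eval 0ᵉ       = 0ℚ , 0ℚ
eval 1ᵉ       = 1ℚ , 0ℚ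
eval ρᵉ       = 0ℚ , 1ℚ
eval (d *ᵉ e) = eval d *′ eval e
eval (-ᵉ e)   = -′ eval e

-- The entries of Φ(ρ, ρ); the last row uses T = F and U = J.
table : Fin 6 → Fin 6 → Vector Expr 6
table =
  ( (x ∷ A ∷ y ∷ B ∷ C ∷ D ∷ [])
  ∷ (y ∷ x ∷ E ∷ F ∷ G ∷ H ∷ [])
  ∷ (I ∷ y ∷ x ∷ J ∷ K ∷ L ∷ [])
  ∷ (M ∷ D ∷ N ∷ z ∷ O ∷ w ∷ [])
  ∷ (P ∷ C ∷ Q ∷ w ∷ z ∷ R ∷ [])
  ∷ (F ∷ B ∷ J ∷ S ∷ w ∷ z ∷ [])
  ∷ [] )
  where
  𝒰 : (t₀ t₁ t₂ t₃ : Expr) → Vector Expr 6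
  𝒰 t₀ t₁ t₂ t₃ = t₀ ∷ t₁ ∷ t₂ ∷ t₃ ∷ 0ᵉ ∷ 0ᵉ ∷ []

  𝒱 : (t₄ t₅ : Expr) → Vector Expr 6
  𝒱 t₄ t₅ = 0ᵉ ∷ 0ᵉ ∷ 0ᵉ ∷ 0ᵉ ∷ t₄ ∷ t₅ ∷ []

  -- Kept as a product rather than the constant `½`, so that `evalᴿ h` is literally `aρ` and `bρ` at
  -- `a = b = ρ`.
  h : Expr
  h = ρᵉ *ᵉ ρᵉ

  A B C D E F G H I J K L M N O P Q R S x y z w : Vector Expr 6
  A = 𝒰 1ᵉ 0ᵉ 0ᵉ 0ᵉ
  B = 𝒰 0ᵉ 1ᵉ 0ᵉ 0ᵉ
  C = 𝒰 0ᵉ 0ᵉ 1ᵉ 0ᵉ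
  D = 𝒰 0ᵉ 0ᵉ 0ᵉ 1ᵉ
  E = 𝒰 0ᵉ ρᵉ h h
  F = 𝒰 ρᵉ 0ᵉ h (-ᵉ h)
  G = 𝒰 h (-ᵉ h) 0ᵉ ρᵉ
  H = 𝒰 (-ᵉ h) (-ᵉ h) ρᵉ 0ᵉ
  I = 𝒰 0ᵉ (-ᵉ ρᵉ) h h
  J = 𝒰 (-ᵉ ρᵉ) 0ᵉ h (-ᵉ h)
  K = 𝒰 (-ᵉ h) h 0ᵉ ρᵉ
  L = 𝒰 h h ρᵉ 0ᵉ
  M = 𝒰 (-ᵉ h) h ρᵉ 0ᵉ
  N = 𝒰 h (-ᵉ h) ρᵉ 0ᵉ
  O = 𝒰 ρᵉ ρᵉ 0ᵉ 0ᵉ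
  P = 𝒰 h h 0ᵉ ρᵉ
  Q = 𝒰 (-ᵉ h) (-ᵉ h) 0ᵉ ρᵉ
  R = 𝒰 (-ᵉ ρᵉ) ρᵉ 0ᵉ 0ᵉ
  S = 𝒰 0ᵉ 0ᵉ ρᵉ ρᵉ
  x = 𝒱 1ᵉ 0ᵉ
  y = 𝒱 0ᵉ 1ᵉ
  z = 𝒱 ρᵉ ρᵉ
  w = 𝒱 ρᵉ (-ᵉ ρᵉ)

tabulate-injective : ∀ {a} {A : Set a} {n} {f g : Fin n → A} →
                     tabulate f ≡ tabulate g → ∀ i → f i ≡ g i
tabulate-injective {f = f} {g} eq i =
  trans (sym (lookup∘tabulate f i)) (trans (cong (λ v → lookup v i) eq) (lookup∘tabulate g i))

-- Tabulated, both sides are closed vectors, so one refl compares all 216 components.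
Φ₂₃-table : ∀ i j k → Φ₂₃ i j k ≡ real (evalᴿ (table i j k))
Φ₂₃-table i j = tabulate-injective
  (tabulate-injective {f = λ j → tabulate (Φ₂₃ i j)}
                      {g = λ j → tabulate λ k → real (evalᴿ (table i j k))}
    (tabulate-injective {f = λ i → tabulate λ j → tabulate (Φ₂₃ i j)}
                        {g = λ i → tabulate λ j → tabulate λ k → real (evalᴿ (table i j k))}
      refl i) j)

infix 7 _∙′_

-- Elements of ℚ(ρ) are real, so the Hermitian product becomes this bilinear one.
_∙′_ : ∀ {n} → Vector ℚ[ρ] n → Vector ℚ[ρ] n → ℚ[ρ]
u ∙′ v = sum′ λ k → u k *′ v k

Orthonormal : ∀ {m n} → Vector (Vector ℚ[ρ] n) m → Set
Orthonormal v = (∀ i → v i ∙′ v i ≡ (1ℚ , 0ℚ)) × (∀ i j → i ≢ j → v i ∙′ v j ≡ (0ℚ , 0ℚ))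

orthonormal? : ∀ {m n} (v : Vector (Vector ℚ[ρ] n) m) → Dec (Orthonormal v)
orthonormal? v =
  (all? λ i → v i ∙′ v i ≟′ (1ℚ , 0ℚ)) ×-dec
  (all? λ i → all? λ j → ¬? (i ≟ᶠ j) →-dec (v i ∙′ v j ≟′ (0ℚ , 0ℚ)))

array : Fin 6 → Fin 6 → Vector ℚ[ρ] 6
array i j k = eval (table i j k)

-- Interpretation of ℚ(ρ) in ℝ and ℂ.

module Ringᶜ = CommutativeRing ℂ-commutativeRing
open LinearAlgebra ℂ-commutativeRing

⟦_⟧ : ℚ[ρ] → ℝ
⟦ p , q ⟧ = fromℚ p +ᴿ fromℚ q *ᴿ ρ

⟦⟧-homo-+ : ∀ s t → ⟦ s ⟧ +ᴿ ⟦ t ⟧ ≈ᴿ ⟦ s +′ t ⟧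
⟦⟧-homo-+ s@(p , q) t@(p′ , q′) = ≈ᴿ-pointwise (⟦ s ⟧ +ᴿ ⟦ t ⟧) ⟦ s +′ t ⟧
  λ n → solve 5 (λ p q p′ q′ l →
    (p :+ q :* l) :+ (p′ :+ q′ :* l) := (p :+ p′) :+ (q :+ q′) :* l) refl p q p′ q′ (lower n)

⟦⟧-homo-- : ∀ s → -ᴿ ⟦ s ⟧ ≈ᴿ ⟦ -′ s ⟧
⟦⟧-homo-- s@(p , q) = ≈ᴿ-pointwise (-ᴿ ⟦ s ⟧) ⟦ -′ s ⟧
  λ n → solve 3 (λ p q l → :- (p :+ q :* l) := :- p :+ :- q :* l) refl p q (lower n)

-- Unlike the laws for sums and negatives, this one is not exact at each index: the two sides differ
-- by `½ q q′ (2 l² - 1)` with `l = lower n`, which is null by `ρ²+ρ²≈1`.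
⟦⟧-homo-* : ∀ s t → ⟦ s ⟧ *ᴿ ⟦ t ⟧ ≈ᴿ ⟦ s *′ t ⟧
⟦⟧-homo-* (p , q) (p′ , q′) = null-linear (fromℚ (½ * (q * q′))) 0ᴿ ρ²+ρ²≈1 ρ²+ρ²≈1
  λ n → solve 5 (λ p q p′ q′ l →
      con ½ :* (q :* q′) :* (l :* l :+ l :* l :- con 1ℚ) :+ con 0ℚ :* (l :* l :+ l :* l :- con 1ℚ)
      := (p :+ q :* l) :* (p′ :+ q′ :* l)
         :- ((p :* p′ :+ con ½ :* (q :* q′)) :+ (p :* q′ :+ q :* p′) :* l))
    refl p q p′ q′ (lower n)

-- This turns an equality of real numbers back into an exact rational one: for `r ≢ 0ℚ` the choice
-- `ε = ∣ r ∣` would give `∣ r ∣ < ∣ r ∣`.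
null-const : ∀ {r} → Null (λ _ → r) → r ≡ 0ℚ
null-const {r} null with r ≟ 0ℚ
... | yes r≡0 = r≡0
... | no  r≢0 = ⊥-elim (<-irrefl refl (proj₂ (null ∣ r ∣ 0<∣r∣) _ ℕ.≤-refl))
  where
  0<∣r∣ : 0ℚ < ∣ r ∣
  0<∣r∣ = ≰⇒> λ ∣r∣≤0 → r≢0 (∣p∣≡0⇒p≡0 r (≤-antisym ∣r∣≤0 (0≤∣p∣ r)))

-- Multiplying d + e ρ ≈ 0 by d − e ρ leaves the rational norm.
≈⇒norm≡0 : ∀ s t → ⟦ s ⟧ ≈ᴿ ⟦ t ⟧ → norm (s -′ t) ≡ 0ℚ
≈⇒norm≡0 s@(p , q) t@(p′ , q′) s≈t = null-const
  (null-linear ⟦ p - p′ , - (q - q′) ⟧ (fromℚ (½ * ((q - q′) * (q - q′)))) s≈t ρ²+ρ²≈1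
    λ n → solve 5 (λ p q p′ q′ l → let d = p :- p′; e = q :- q′ in
        (d :+ :- e :* l) :* ((p :+ q :* l) :- (p′ :+ q′ :* l))
        :+ con ½ :* (e :* e) :* (l :* l :+ l :* l :- con 1ℚ)
        := d :* d :- con ½ :* (e :* e))
      refl p q p′ q′ (lower n))

evalᴿ≈⟦eval⟧ : ∀ e → evalᴿ e ≈ᴿ ⟦ eval e ⟧
evalᴿ≈⟦eval⟧ 0ᵉ = ≈ᴿ-pointwise 0ᴿ ⟦ eval 0ᵉ ⟧
  λ n → solve 1 (λ l → con 0ℚ := con 0ℚ :+ con 0ℚ :* l) refl (lower n)
evalᴿ≈⟦eval⟧ 1ᵉ = ≈ᴿ-pointwise 1ᴿ ⟦ eval 1ᵉ ⟧
  λ n → solve 1 (λ l → con 1ℚ := con 1ℚ :+ con 0ℚ :* l) refl (lower n)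
evalᴿ≈⟦eval⟧ ρᵉ = ≈ᴿ-pointwise ρ ⟦ eval ρᵉ ⟧
  λ n → solve 1 (λ l → l := con 0ℚ :+ con 1ℚ :* l) refl (lower n)
evalᴿ≈⟦eval⟧ (d *ᵉ e) =
  ≈ᴿ-trans (evalᴿ d *ᴿ evalᴿ e) (⟦ eval d ⟧ *ᴿ ⟦ eval e ⟧) ⟦ eval d *′ eval e ⟧
    (*ᴿ-cong (evalᴿ d) ⟦ eval d ⟧ (evalᴿ e) ⟦ eval e ⟧ (evalᴿ≈⟦eval⟧ d) (evalᴿ≈⟦eval⟧ e))
    (⟦⟧-homo-* (eval d) (eval e))
evalᴿ≈⟦eval⟧ (-ᵉ e) =
  ≈ᴿ-trans (-ᴿ evalᴿ e) (-ᴿ ⟦ eval e ⟧) ⟦ -′ eval e ⟧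
    (-ᴿ-cong (evalᴿ e) ⟦ eval e ⟧ (evalᴿ≈⟦eval⟧ e)) (⟦⟧-homo-- (eval e))

infix 4 _∼_

_∼_ : ℂ → ℚ[ρ] → Set
z ∼ s = z ≈ᶜ real ⟦ s ⟧

∼-+ : ∀ z w s t → z ∼ s → w ∼ t → z +ᶜ w ∼ s +′ t
∼-+ z w s t (p , q) (p′ , q′) =
    ≈ᴿ-trans (re z +ᴿ re w) (⟦ s ⟧ +ᴿ ⟦ t ⟧) ⟦ s +′ t ⟧
      (+ᴿ-cong (re z) ⟦ s ⟧ (re w) ⟦ t ⟧ p p′) (⟦⟧-homo-+ s t)
  , ≈ᴿ-trans (im z +ᴿ im w) (0ᴿ +ᴿ 0ᴿ) 0ᴿ
      (+ᴿ-cong (im z) 0ᴿ (im w) 0ᴿ q q′) (≈ᴿ-pointwise (0ᴿ +ᴿ 0ᴿ) 0ᴿ λ _ → refl)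

real-* : ∀ x y → real x *ᶜ real y ≈ᶜ real (x *ᴿ y)
real-* x y = ≈ᶜ-pointwise (real x *ᶜ real y) (real (x *ᴿ y))
  (λ n → +-identityʳ (seq x n * seq y n))
  (λ n → solve 2 (λ a b → a :* con 0ℚ :+ con 0ℚ :* b := con 0ℚ) refl (seq x n) (seq y n))

∼-* : ∀ z w s t → z ∼ s → w ∼ t → z *ᶜ w ∼ s *′ t
∼-* z w s t p q =
  Ringᶜ.trans {z *ᶜ w} {real ⟦ s ⟧ *ᶜ real ⟦ t ⟧} {real ⟦ s *′ t ⟧}
    (Ringᶜ.*-cong {z} {real ⟦ s ⟧} {w} {real ⟦ t ⟧} p q)
    (Ringᶜ.trans {real ⟦ s ⟧ *ᶜ real ⟦ t ⟧} {real (⟦ s ⟧ *ᴿ ⟦ t ⟧)} {real ⟦ s *′ t ⟧}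
      (real-* ⟦ s ⟧ ⟦ t ⟧) (⟦⟧-homo-* s t , ≈ᴿ-refl 0ᴿ))

∼-conj : ∀ z s → z ∼ s → conj z ∼ s
∼-conj z s (p , q) = p
  , ≈ᴿ-trans (-ᴿ im z) (-ᴿ 0ᴿ) 0ᴿ (-ᴿ-cong (im z) 0ᴿ q) (≈ᴿ-pointwise (-ᴿ 0ᴿ) 0ᴿ λ _ → refl)

∼-inner : ∀ {n} (u v : ℂ^ n) (a b : Vector ℚ[ρ] n) → (∀ k → u k ∼ a k) → (∀ k → v k ∼ b k) →
          ⟨ u , v ⟩ ∼ a ∙′ b
∼-inner {ℕ.zero}  u v a b p q = ≈ᶜ-pointwise 0ᶜ (real ⟦ 0ℚ , 0ℚ ⟧)
  (λ n → solve 1 (λ l → con 0ℚ := con 0ℚ :+ con 0ℚ :* l) refl (lower n)) (λ _ → refl)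
∼-inner {ℕ.suc n} u v a b p q =
  ∼-+ (conj (u zero) *ᶜ v zero) ⟨ u ∘ suc , v ∘ suc ⟩
      (a zero *′ b zero) ((a ∘ suc) ∙′ (b ∘ suc))
    (∼-* (conj (u zero)) (v zero) (a zero) (b zero) (∼-conj (u zero) (a zero) (p zero)) (q zero))
    (∼-inner (u ∘ suc) (v ∘ suc) (a ∘ suc) (b ∘ suc) (p ∘ suc) (q ∘ suc))

orthonormal⇒dual : ∀ {m n} (v : Vector (ℂ^ n) m) (a : Vector (Vector ℚ[ρ] n) m) →
  (∀ i k → v i k ∼ a i k) → Orthonormal a → Dual (λ i k → conj (v i k)) v
orthonormal⇒dual v a v∼a (on , off) =
    (λ i → Ringᶜ.trans {⟨ v i , v i ⟩} {real ⟦ 1ℚ , 0ℚ ⟧} {1ᶜ}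
      (subst (⟨ v i , v i ⟩ ∼_) (on i) (∼-inner (v i) (v i) (a i) (a i) (v∼a i) (v∼a i)))
      (Ringᶜ.sym {1ᶜ} {real ⟦ 1ℚ , 0ℚ ⟧} (evalᴿ≈⟦eval⟧ 1ᵉ , ≈ᴿ-refl 0ᴿ)))
  , (λ i j i≢j → Ringᶜ.trans {⟨ v i , v j ⟩} {real ⟦ 0ℚ , 0ℚ ⟧} {0ᶜ}
      (subst (⟨ v i , v j ⟩ ∼_) (off i j i≢j) (∼-inner (v i) (v j) (a i) (a j) (v∼a i) (v∼a j)))
      (Ringᶜ.sym {0ᶜ} {real ⟦ 0ℚ , 0ℚ ⟧} (evalᴿ≈⟦eval⟧ 0ᵉ , ≈ᴿ-refl 0ᴿ)))

-- Orthonormality of `a` makes `v` dual to its conjugate, which gives independence; orthonormality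
-- of the transpose gives the resolution of the identity behind spanning.
unitary⇒basis : ∀ {m n} (v : Vector (ℂ^ n) m) (a : Vector (Vector ℚ[ρ] n) m) →
  (∀ i k → v i k ∼ a i k) → Orthonormal a → Orthonormal (flip a) → IsOrthonormalBasis v
unitary⇒basis v a v∼a o oᵀ = record
  { unit        = proj₁ dual
  ; orthogonal  = proj₂ dual
  ; independent = dual⇒independent v* v dual
  -- The coefficients are the Fourier coefficients `⟨ v i , w ⟩`, with the factors of each product
  -- exchanged.
  ; spanning    = λ w → (λ i → w ∙ v* i) , dualᵀ⇒spanning v* v dualᵀ w
  }
  where
  v* = λ i k → conj (v i k)
  dual : Dual v* v
  dual = orthonormal⇒dual v a v∼a o
  dualᵀ : Dual (flip v*) (flip v)
  dualᵀ = orthonormal⇒dual (flip v) (flip a) (flip v∼a) oᵀ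

-- The exponential series at 0.

≈0⇒<pos : ∀ x {r} → 0ℚ < r → x ≈ᴿ 0ᴿ → x <ᴿ fromℚ r
≈0⇒<pos x {r} 0<r x≈0 =
  let N , h = x≈0 (½ * r) (0<½* 0<r) in
  -- The relation `_<ᴿ_` demands a uniform gap: one half of `r` bounds the sequence, the other half
  -- is the gap.
  ½ * r , 0<½* 0<r , N , λ n N≤n →
    subst (seq x n + ½ * r ≤_) (half r) (+-monoˡ-≤ (½ * r)
      (≤-trans (p≤∣p∣ (seq x n))
        (<⇒≤ (subst (λ t → ∣ t ∣ < ½ * r) (+-identityʳ (seq x n)) (h n N≤n)))))
  where
  p≤∣p∣ : ∀ p → p ≤ ∣ p ∣
  p≤∣p∣ p with 0ℚ ≤? p
  ... | yes 0≤p = ≤-reflexive (sym (0≤p⇒∣p∣≡p 0≤p))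
  ... | no  0≰p = ≤-trans (<⇒≤ (≰⇒> 0≰p)) (0≤∣p∣ p)

-- The index starts at 1 because the empty partial sum of a series is 0; all later partial sums of
-- the exponential series at 0 equal 1.
eventually-constant⇒⟶ : ∀ s c → (∀ n → s (ℕ.suc n) ≈ᶜ c) → s ⟶ c
eventually-constant⇒⟶ s c s≈c ε 0<ε =
  1 , λ { (ℕ.suc n) _ → ≈0⇒<pos ∣ s (ℕ.suc n) +ᶜ -ᶜ c ∣² 0<ε² (null (s (ℕ.suc n)) (s≈c n)) }
  where
  0<ε² : 0ℚ < ε * ε
  0<ε² = positive⁻¹ (ε * ε) {{pos*pos⇒pos ε {{positive 0<ε}} ε {{positive 0<ε}}}}
  null : ∀ z → z ≈ᶜ c → ∣ z +ᶜ -ᶜ c ∣² ≈ᴿ 0ᴿ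
  null z z≈c =
    let d = z +ᶜ -ᶜ c
        p , q = Ringᶜ.trans {d} {c +ᶜ -ᶜ c} {0ᶜ}
          (Ringᶜ.+-cong {z} {c} { -ᶜ c} { -ᶜ c} z≈c (Ringᶜ.refl { -ᶜ c})) (Ringᶜ.-‿inverseʳ c)
    in ≈ᴿ-trans ∣ d ∣² ∣ 0ᶜ ∣² 0ᴿ
         (+ᴿ-cong (re d *ᴿ re d) (0ᴿ *ᴿ 0ᴿ) (im d *ᴿ im d) (0ᴿ *ᴿ 0ᴿ)
           (*ᴿ-cong (re d) 0ᴿ (re d) 0ᴿ p p) (*ᴿ-cong (im d) 0ᴿ (im d) 0ᴿ q q))
         (≈ᴿ-pointwise ∣ 0ᶜ ∣² 0ᴿ λ _ → refl)

exp-0-term : ℕ → ℂ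
exp-0-term k = real (fromℚ (reciprocal! k)) *ᶜ 0ᶜ ^ᶜ k

exp-0 : IsExp 0ᶜ 1ᶜ
exp-0 = eventually-constant⇒⟶ (λ n → sum {n} (exp-0-term ∘ toℕ)) 1ᶜ λ n →
  Ringᶜ.trans {sum {ℕ.suc n} (exp-0-term ∘ toℕ)} {exp-0-term 0} {1ᶜ}
    (sum-supported (exp-0-term ∘ toℕ) (zero {n}) λ
      { zero    0≢0 → ⊥-elim (0≢0 refl)
      ; (suc k) _   → vanish (real (fromℚ (reciprocal! (ℕ.suc (toℕ k))))) (0ᶜ ^ᶜ toℕ k)
      })
    -- The surviving term is `1/0!` times `0⁰`, both of which evaluate to 1.
    (Ringᶜ.*-identityʳ 1ᶜ)
  where
  vanish : ∀ z w → z *ᶜ (0ᶜ *ᶜ w) ≈ᶜ 0ᶜ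
  vanish z w = Ringᶜ.trans {z *ᶜ (0ᶜ *ᶜ w)} {z *ᶜ 0ᶜ} {0ᶜ}
    (Ringᶜ.*-cong {z} {z} {0ᶜ *ᶜ w} {0ᶜ} (Ringᶜ.refl {z}) (Ringᶜ.zeroˡ w)) (Ringᶜ.zeroʳ z)

≈⇒phaseEquivalent : ∀ {n} (u v : ℂ^ n) → (∀ k → u k ≈ᶜ v k) → PhaseEquivalent u v
≈⇒phaseEquivalent u v u≈v = 0ᴿ , 1ᶜ , exp-0 , λ k →
  Ringᶜ.trans {u k} {v k} {1ᶜ *ᶜ v k} (u≈v k)
    (Ringᶜ.sym {1ᶜ *ᶜ v k} {v k} (Ringᶜ.*-identityˡ (v k)))

-- Orthonormality of the rows and columns.

Φ₂₃∼array : ∀ i j k → Φ₂₃ i j k ∼ array i j k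
Φ₂₃∼array i j k = subst (_∼ array i j k) (sym (Φ₂₃-table i j k))
  (evalᴿ≈⟦eval⟧ (table i j k) , ≈ᴿ-refl 0ᴿ)

abstract

  -- These four facts are finite checks settled by evaluating the decision procedure in exact
  -- arithmetic.
  array-rows : ∀ i → Orthonormal (array i)
  array-rows = from-yes (all? λ i → orthonormal? (array i))

  array-rowsᵀ : ∀ i → Orthonormal (flip (array i))
  array-rowsᵀ = from-yes (all? λ i → orthonormal? (flip (array i)))

  array-columns : ∀ j → Orthonormal (λ i → array i j)
  array-columns = from-yes (all? λ j → orthonormal? (λ i → array i j))

  array-columnsᵀ : ∀ j → Orthonormal (flip λ i → array i j)
  array-columnsᵀ = from-yes (all? λ j → orthonormal? (flip λ i → array i j))

Φ₂₃-isQuantumLatinSquare : IsQuantumLatinSquare Φ₂₃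
Φ₂₃-isQuantumLatinSquare = record
  { unit    = λ i → IsOrthonormalBasis.unit (rows i)
  ; rows    = rows
  ; columns = λ j → unitary⇒basis (λ i → Φ₂₃ i j) (λ i → array i j) (λ i → Φ₂₃∼array i j)
      (array-columns j) (array-columnsᵀ j)
  }
  where
  rows : ∀ i → IsOrthonormalBasis (Φ₂₃ i)
  rows i = unitary⇒basis (Φ₂₃ i) (array i) (Φ₂₃∼array i) (array-rows i) (array-rowsᵀ i)

-- The 23 phase classes.

-- One cell for each of the 23 vectors A, …, S, x, y, z, w.
cell : Fin 23 → Fin 6 × Fin 6
cell =
  ( (0F , 0F) ∷ (0F , 1F) ∷ (0F , 2F) ∷ (0F , 3F) ∷ (0F , 4F) ∷ (0F , 5F)
  ∷ (1F , 2F) ∷ (1F , 3F) ∷ (1F , 4F) ∷ (1F , 5F)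
  ∷ (2F , 0F) ∷ (2F , 3F) ∷ (2F , 4F) ∷ (2F , 5F)
  ∷ (3F , 0F) ∷ (3F , 2F) ∷ (3F , 3F) ∷ (3F , 4F) ∷ (3F , 5F)
  ∷ (4F , 0F) ∷ (4F , 2F) ∷ (4F , 5F)
  ∷ (5F , 3F) ∷ [])

entry : Fin 6 × Fin 6 → Vector ℚ[ρ] 6
entry (i , j) = array i j

minor : ∀ {n} → Vector ℚ[ρ] n → Vector ℚ[ρ] n → Fin n → Fin n → ℚ[ρ]
minor u v k l = u k *′ v l -′ u l *′ v k

-- Phase equivalence is in particular proportionality, so the minors vanish in ℂ. Passing to the
-- norm makes this a decidable condition on rationals.
phaseEquivalent⇒minors-vanish : ∀ {n} (u v : ℂ^ n) (a b : Vector ℚ[ρ] n) →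
  (∀ k → u k ∼ a k) → (∀ k → v k ∼ b k) → PhaseEquivalent u v →
  ∀ k l → norm (minor a b k l) ≡ 0ℚ
phaseEquivalent⇒minors-vanish u v a b u∼a v∼b (_ , c , _ , u≈cv) k l =
  ≈⇒norm≡0 (a k *′ b l) (a l *′ b k) (proj₁
    (Ringᶜ.trans {real ⟦ a k *′ b l ⟧} {u k *ᶜ v l} {real ⟦ a l *′ b k ⟧}
      (Ringᶜ.sym {u k *ᶜ v l} {real ⟦ a k *′ b l ⟧} (∼-* (u k) (v l) (a k) (b l) (u∼a k) (v∼b l)))
      (Ringᶜ.trans {u k *ᶜ v l} {u l *ᶜ v k} {real ⟦ a l *′ b k ⟧}
        (parallel⇒minors-vanish u v c u≈cv k l)
        (∼-* (u l) (v k) (a l) (b k) (u∼a l) (v∼b k)))))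

abstract

  -- Checked for all pairs of the 23 cells: two distinct ones always have some minor of nonzero
  -- norm.
  cells-separated : ∀ x y → (∀ k l → norm (minor (entry (cell x)) (entry (cell y)) k l) ≡ 0ℚ) → x ≡ y
  cells-separated = from-yes (all? λ x → all? λ y →
    (all? λ k → all? λ l → norm (minor (entry (cell x)) (entry (cell y)) k l) ≟ 0ℚ) →-dec (x ≟ᶠ y))

  -- Repeated entries of the array agree componentwise, without a sign or other phase, so a search
  -- for exact equality succeeds.
  cells-cover : ∀ i j → ∃[ x ] ∀ k → entry (cell x) k ≡ entry (i , j) k
  cells-cover = from-yes (all? λ i → all? λ j → any? λ x → all? λ k →
    entry (cell x) k ≟′ entry (i , j) k)

at : Fin 6 × Fin 6 → ℂ^ 6
at (i , j) = Φ₂₃ i j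

at∼entry : ∀ p k → at p k ∼ entry p k
at∼entry (i , j) = Φ₂₃∼array i j

phaseEquivalent⇒≡ : ∀ x y → PhaseEquivalent (at (cell x)) (at (cell y)) → x ≡ y
phaseEquivalent⇒≡ x y pe = cells-separated x y
  (phaseEquivalent⇒minors-vanish (at (cell x)) (at (cell y)) (entry (cell x)) (entry (cell y))
    (at∼entry (cell x)) (at∼entry (cell y)) pe)

≡⇒phaseEquivalent : ∀ p q → (∀ k → entry p k ≡ entry q k) → PhaseEquivalent (at p) (at q)
≡⇒phaseEquivalent p q eq = ≈⇒phaseEquivalent (at p) (at q) λ k →
  Ringᶜ.trans {at p k} {real ⟦ entry p k ⟧} {at q k} (at∼entry p k)
    (Ringᶜ.sym {at q k} {real ⟦ entry p k ⟧}
      (subst (at q k ∼_) (sym (eq k)) (at∼entry q k)))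

Φ₂₃-cardinality : HasCardinality Φ₂₃ 23
Φ₂₃-cardinality = cell
  , (λ {x} {y} → phaseEquivalent⇒≡ x y)
  , λ (i , j) → let x , eq = cells-cover i j in
      -- Surjectivity quantifies over every index equal to `x`, hence the match on `refl`.
      x , λ { refl → ≡⇒phaseEquivalent (cell x) (i , j) eq }

theorem3 : IsQuantumLatinSquare Φ₂₃ × HasCardinality Φ₂₃ 23
theorem3 = Φ₂₃-isQuantumLatinSquare , Φ₂₃-cardinality
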